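{- A monotonicity constraint system (MCS) $\mathcal A$ is size-change terminating if and only if every cyclic monotonicity constraint in $\mathcal A^*$ passes the Local Termination Test.
   Context: Fix a number $n$ of variables. A monotonicity constraint (MC) is a finite conjunction of constraints $u\rhd v$ with $\rhd\in\{>,\ge\}$ and $u,v\in\{x_1,\dots,x_n,x_1',\dots,x_n'\}$ (unprimed: source; primed: target). It is identified with the labeled digraph on these $2n$ nodes having an arc $u\to v$ labeled $\rhd$ for each constraint $u\rhd v$; arcs labeled $>$ are strict, arcs labeled $\ge$ non-strict. An MCS $\mathcal A$ consists of a finite set $F$ of flow-points; a finite directed graph (control-flow graph, CFG; loops and parallel arcs allowed) on $F$; for every CFG arc $f\to g$ an MC $G$ labeling it (written $G:f\to g$); and for every flow-point $f$ an invariant $I_f$, a conjunction of constraints among $x_1,\dots,x_n$ (also viewed as labeled arcs). Multipaths: for a (finite, with at least one arc, or infinite) labeled CFG path $f_0\xrightarrow{G_1}f_1\xrightarrow{G_2}f_2\cdots$ (repetitions allowed), the corresponding $\mathcal A$-multipath is the labeled digraph with nodes $x[t,i]$ ($t$ from $0$ up to the length of the path, $1\le i\le n$), whose arcs are: for each $t\ge1$, the arcs of $G_t$ with $x_i$ renamed to $x[t-1,i]$ and $x_j'$ renamed to $x[t,j]$; and for each $t\ge0$, the arcs of $I_{f_t}$ with $x_i$ renamed to $x[t,i]$. A multipath is satisfiable if there is an assignment of elements of some well-ordered set to its nodes satisfying all constraints expressed by its arcs; a finite multipath is satisfiable iff it has no directed cycle containing a strict arc. A walk (nodes and arcs may repeat;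 arcs may be followed in any temporal direction they have) is descending if it contains a strict arc, and infinitely descending if it contains infinitely many occurrences of strict arcs. $\mathcal A$ is size-change terminating if every infinite $\mathcal A$-multipath has an infinitely descending walk. Collapse: for a finite satisfiable multipath $M=G_1\cdots G_\ell$ from $f_0$ to $f_\ell$, $\overline M$ is the MC with source $f_0$ and target $f_\ell$ consisting of all constraints among its $2n$ variables implied by $M$, where $x_i$ stands for $x[0,i]$ and $x_j'$ for $x[\ell,j]$: it has an arc $u\to v$ iff $M$ has a walk from the node of $u$ to the node of $v$, and the arc is strict iff there is such a walk that is descending. The closure set is $\mathcal A^*=\{\overline M\mid M\text{ a finite satisfiable }\mathcal A\text{ -multipath}\}$. An MC is cyclic if its source and target flow-points are equal. The circular variant $G^\circ$ of a cyclic MC $G$ is the digraph obtained from $G$ by adding, for every $i$, a shortcut edge $x_i\leftrightarrow x_i'$, treated as a pair of non-strict arcs $x_i\to x_i'$ (forward direction) and $x_i'\to x_i$ (backward direction), distinguished from arcs already present in $G$. A cycle in $G^\circ$ is a closed directed walk (nodes and arcs may repeat). It is a forward cycle if it traverses shortcut edges more often in the backward direction than in the forward direction; balanced if equally often in both directions; descending if it includes a strict arc. $G$ passes the Local Termination Test if $G^\circ$ has a descending cycle that is either forward or balanced. -}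

module Defs where

open import Level using (0ℓ)
open import Data.Nat using (ℕ; zero; suc; _≤_; _<_)
open import Data.Fin using (Fin; zero; suc; inject₁; fromℕ)
open import Data.List using (List)
open import Data.List.Membership.Propositional using (_∈_)
open import Data.Product using (Σ-syntax; ∃-syntax; _×_; _,_)
open import Data.Sum using (_⊎_)
open import Data.Empty using (⊥)
open import Function.Base using (id)
open import Function.Bundles using (_⇔_)
open import Induction.WellFounded using (WellFounded)
open import Relation.Binary.Bundles using (StrictTotalOrder)
open import Relation.Binary.PropositionalEquality using (_≡_)

data Label : Set where
  strict nonstrict : Label

-- (u , strict , v) is u > v and (u , nonstrict , v) is u ≥ v; both are read
-- as an arc from u to v.
Constraint : Set → Set
Constraint V = V × Label × V

-- x i is a source variable, x′ i a target variable.
data Var (n : ℕ) : Set where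
  x x′ : Fin n → Var n

MC : ℕ → Set
MC n = List (Constraint (Var n))

Invariant : ℕ → Set
Invariant n = List (Constraint (Fin n))

-- The control-flow graph is a finite directed multigraph, hence its arcs are
-- named and have endpoints.
record MCS (n : ℕ) : Set where
  field
    #points : ℕ
    #arcs   : ℕ
    source  : Fin #arcs → Fin #points
    target  : Fin #arcs → Fin #points
    mc      : Fin #arcs → MC n
    inv     : Fin #points → Invariant n

  FlowPoint : Set
  FlowPoint = Fin #points

Digraph : Set → Set₁
Digraph V = V → Label → V → Set

module _ {V : Set} (D : Digraph V) where

  infixr 5 _∷_

  data Walk : V → V → Set where
    []  : ∀ {u} → Walk u u
    _∷_ : ∀ {u l v w} → D u l v → Walk v w → Walk u w

  record InfiniteWalk : Set where
    field
      node  : ℕ → V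
      label : ℕ → Label
      arc   : ∀ k → D (node k) (label k) (node (suc k))

  InfinitelyDescending : InfiniteWalk → Set
  InfinitelyDescending w = ∀ k → ∃[ m ] (k ≤ m × InfiniteWalk.label w m ≡ strict)

  -- The well-ordered set is a set of the lowest universe; the digraphs this
  -- is applied to are finite.
  Satisfiable : Set₁
  Satisfiable =
    Σ[ W ∈ StrictTotalOrder 0ℓ 0ℓ 0ℓ ]
      let module W = StrictTotalOrder W in
      WellFounded W._<_ ×
      Σ[ σ ∈ (V → W.Carrier) ]
        ((∀ {u v} → D u strict v → σ v W.< σ u) ×
         (∀ {u v} → D u nonstrict v → σ v W.< σ u ⊎ σ v W.≈ σ u))

Descending : ∀ {V} {D : Digraph V} {u v} → Walk D u v → Set
Descending []              = ⊥
Descending (_∷_ {l = l} _ w) = l ≡ strict ⊎ Descending w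

-- Finite and infinite paths share one definition: Step indexes the arcs of
-- the path, Time its flow-points, and step s leads from time before s to time
-- after s.
record Path {n} (𝒜 : MCS n) {Time Step : Set} (before after : Step → Time) : Set where
  open MCS 𝒜
  field
    point   : Time → FlowPoint
    arc     : Step → Fin #arcs
    departs : ∀ s → source (arc s) ≡ point (before s)
    arrives : ∀ s → target (arc s) ≡ point (after s)

FinitePath : ∀ {n} → MCS n → ℕ → Set
FinitePath 𝒜 ℓ = Path 𝒜 {Fin (suc ℓ)} {Fin ℓ} inject₁ suc

InfinitePath : ∀ {n} → MCS n → Set
InfinitePath 𝒜 = Path 𝒜 {ℕ} {ℕ} id suc

-- at s t renames x i to x[s,i] and x′ j to x[t,j].
at : ∀ {n} {Time : Set} → Time → Time → Var n → Time × Fin n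
at s t (x i)  = s , i
at s t (x′ j) = t , j

module _ {n} {𝒜 : MCS n} {Time Step : Set} {before after : Step → Time} where
  open MCS 𝒜

  data Multipath (p : Path 𝒜 before after) : Digraph (Time × Fin n) where
    transition : ∀ s {u l v} → (u , l , v) ∈ mc (Path.arc p s) →
                 Multipath p (at (before s) (after s) u) l (at (before s) (after s) v)
    invariant  : ∀ t {i l j} → (i , l , j) ∈ inv (Path.point p t) →
                 Multipath p (t , i) l (t , j)

SizeChangeTerminating : ∀ {n} → MCS n → Set
SizeChangeTerminating 𝒜 =
  (p : InfinitePath 𝒜) →
  Σ[ w ∈ InfiniteWalk (Multipath p) ] InfinitelyDescending (Multipath p) w

-- Characterises the collapse up to order and repetition of its constraints.
-- Empty walks count, as u ≥ u is always implied.
record IsCollapse {n} {𝒜 : MCS n} {ℓ} (p : FinitePath 𝒜 ℓ) (G : MC n) : Set where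
  end : Var n → Fin (suc ℓ) × Fin n
  end = at zero (fromℕ ℓ)

  field
    arc⇔walk    : ∀ u v → (∃[ l ] (u , l , v) ∈ G) ⇔ Walk (Multipath p) (end u) (end v)
    strict⇔desc : ∀ {u l v} → (u , l , v) ∈ G →
                  l ≡ strict ⇔ (Σ[ w ∈ Walk (Multipath p) (end u) (end v) ] Descending w)

-- G : f → g is an element of 𝒜*; the path has suc ℓ arcs, hence at least one.
InClosure : ∀ {n} (𝒜 : MCS n) (f g : MCS.FlowPoint 𝒜) → MC n → Set₁
InClosure 𝒜 f g G =
  ∃[ ℓ ] Σ[ p ∈ FinitePath 𝒜 (suc ℓ) ]
    (Path.point p zero ≡ f × Path.point p (fromℕ (suc ℓ)) ≡ g ×
     Satisfiable (Multipath p) × IsCollapse p G)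

data Circular {n} (G : MC n) : Digraph (Var n) where
  original : ∀ {u l v} → (u , l , v) ∈ G → Circular G u l v
  forward  : ∀ i → Circular G (x i) nonstrict (x′ i)
  backward : ∀ i → Circular G (x′ i) nonstrict (x i)

module _ {n} {G : MC n} where

  #forward : ∀ {u v} → Walk (Circular G) u v → ℕ
  #forward []               = 0
  #forward (original _ ∷ w) = #forward w
  #forward (forward _ ∷ w)  = suc (#forward w)
  #forward (backward _ ∷ w) = #forward w

  #backward : ∀ {u v} → Walk (Circular G) u v → ℕ
  #backward []               = 0
  #backward (original _ ∷ w) = #backward w
  #backward (forward _ ∷ w)  = #backward w
  #backward (backward _ ∷ w) = suc (#backward w)

  -- A forward cycle uses more backward than forward shortcuts: following
  -- x′ i → x i amounts to moving on to the next copy of G.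
  ForwardCycle BalancedCycle : ∀ {u} → Walk (Circular G) u u → Set
  ForwardCycle c  = #forward c < #backward c
  BalancedCycle c = #forward c ≡ #backward c

PassesLocalTerminationTest : ∀ {n} → MC n → Set
PassesLocalTerminationTest G =
  ∃[ u ] Σ[ c ∈ Walk (Circular G) u u ]
    (Descending c × (ForwardCycle c ⊎ BalancedCycle c))

{-# OPTIONS --safe #-}
module Submission where

-- ⇒ A collapsed cyclic multipath M, repeated for ever, has an infinitely
-- descending walk. By pigeonhole the walk visits the same node of two copies
-- of M, the later visit in the same or a later copy and with a strict arc in
-- between. Cutting this piece at the copies' boundaries yields a cycle of G°
-- whose backward minus forward shortcuts count the copies advanced.
--
-- ⇐ If some segment of the path has a descending cycle, go round it for ever.
-- Otherwise all segments are satisfiable and, by Ramsey, the path splits into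
-- cyclic segments with one common collapse G. A descending forward or balanced
-- cycle of G° lifts to a walk in the path which ends at the same variable, no
-- earlier than it started, so it can be repeated for ever.

open import Defs
open import Level using (0ℓ)
open import Data.Nat using (ℕ; zero; suc; _+_; _∸_; _≤_; _<_; z≤n; s≤s; _≤′_; _≤‴_; ≤′-refl; ≤′-step; ≤‴-refl; ≤‴-step)
open import Data.Nat.Induction using (<-wellFounded)
open import Data.Nat.Properties
open import Data.Fin using (Fin; zero; suc; inject₁; fromℕ; toℕ)
open import Data.Fin.Properties using (toℕ-fromℕ; toℕ-inject₁)
open import Data.Fin.Relation.Unary.Top using (view; ‵fromℕ; ‵inject₁)
open import Data.List using (List; []; _∷_; _++_; map; filter; length; allFin; cartesianProduct)
open import Data.List.Membership.Propositional using (_∈_)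
open import Data.List.Membership.Propositional.Properties using (∈-map⁺; ∈-++⁺ˡ; ∈-++⁺ʳ; ∈-filter⁺; ∈-filter⁻; ∈-cartesianProduct⁺; ∈-allFin)
open import Data.List.Relation.Unary.Any using (here; there)
open import Data.Product using (Σ-syntax; ∃; ∃-syntax; _×_; _,_; proj₁; proj₂; uncurry)
open import Data.Sum using (_⊎_; inj₁; inj₂; [_,_])
open import Data.Empty using (⊥-elim)
open import Data.Unit using (⊤; tt)
open import Function using (_∘_; id)
open import Function.Bundles using (_⇔_; mk⇔; module Equivalence)
open import Induction.WellFounded using (Acc; acc)
open import Relation.Binary.Bundles using (StrictTotalOrder)
open import Relation.Nullary using (¬_; yes; no; contradiction)
open import Relation.Binary.PropositionalEquality using (_≡_; _≢_; refl; sym; trans; cong; subst; subst₂)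
open import Axiom.ExcludedMiddle using (ExcludedMiddle)

open Equivalence using (to; from)

private
  variable
    V V′ C : Set
    D D′ : Digraph V
    u v w : V
    l : Label
    n ℓ : ℕ

-- Walks

Descent : Digraph V → V → V → Set
Descent D u v = Σ[ w ∈ Walk D u v ] Descending w

infixr 5 _++ʷ_

_++ʷ_ : Walk D u v → Walk D v w → Walk D u w
[]      ++ʷ b = b
(e ∷ a) ++ʷ b = e ∷ (a ++ʷ b)

descending-++ˡ : (a : Walk D u v) {b : Walk D v w} → Descending a → Descending (a ++ʷ b)
descending-++ˡ (e ∷ a) (inj₁ s) = inj₁ s
descending-++ˡ (e ∷ a) (inj₂ d) = inj₂ (descending-++ˡ a d)

descending-++ʳ : (a : Walk D u v) {b : Walk D v w} → Descending b → Descending (a ++ʷ b)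
descending-++ʳ []      d = d
descending-++ʳ (e ∷ a) d = inj₂ (descending-++ʳ a d)

-- Arcs are simulated by walks because one arc may need a detour through shortcuts, or expand into a
-- whole segment. Only strictness has to survive.
Run : Digraph V → V → Label → V → Set
Run D u l v = Σ[ w ∈ Walk D u v ] (l ≡ strict → Descending w)

arcRun : D u l v → Run D u l v
arcRun e = e ∷ [] , inj₁

Simulates : Digraph V → Digraph V′ → (V → V′) → Set
Simulates D D′ φ = ∀ {u l v} → D u l v → Run D′ (φ u) l (φ v)

module _ {φ : V → V′} (sim : Simulates D D′ φ) where

  mapWalk : Walk D u v → Walk D′ (φ u) (φ v)
  mapWalk []      = []
  mapWalk (e ∷ w) = proj₁ (sim e) ++ʷ mapWalk w

  mapWalk-descending : (w : Walk D u v) → Descending w → Descending (mapWalk w)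
  mapWalk-descending (e ∷ w) (inj₁ s) = descending-++ˡ (proj₁ (sim e)) (proj₂ (sim e) s)
  mapWalk-descending (e ∷ w) (inj₂ d) = descending-++ʳ (proj₁ (sim e)) (mapWalk-descending w d)

  mapDescent : Descent D u v → Descent D′ (φ u) (φ v)
  mapDescent (w , d) = mapWalk w , mapWalk-descending w d

module _ (w : InfiniteWalk D) where
  open InfiniteWalk w

  subwalk : ∀ {a b} → a ≤‴ b → Walk D (node a) (node b)
  subwalk ≤‴-refl         = []
  subwalk {a} (≤‴-step p) = arc a ∷ subwalk p

  subwalk-through : ∀ {a s b} → label s ≡ strict → a ≤ s → s < b → Descent D (node a) (node b)
  subwalk-through {s = s} e a≤s s<b =
    subwalk (≤⇒≤‴ a≤s) ++ʷ (arc s ∷ subwalk (≤⇒≤‴ s<b)) ,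
    descending-++ʳ (subwalk (≤⇒≤‴ a≤s)) (inj₁ e)

-- Infinite walks from endless sequences of descents

module Concatenation {S : Set} (place : S → V)
                     (continue : ∀ s → ∃[ s′ ] Descent D (place s) (place s′)) where

  -- The unfinished part of the current descent. It is never empty, so there is always a next arc to
  -- emit; a fresh descent can be loaded because a descending walk has at least one arc.
  data Rest : V → Set where
    rest : ∀ s {u l v} → D u l v → Walk D v (place s) → Rest u

  Strictly : Rest u → Set
  Strictly (rest _ {l = l} _ w) = l ≡ strict ⊎ Descending w

  fromDescent : ∀ s → Descent D u (place s) → Σ[ r ∈ Rest u ] Strictly r
  fromDescent s (e ∷ w , d) = rest s e w , d

  start : ∀ s → Rest (place s)
  start s = let s′ , d = continue s in proj₁ (fromDescent s′ d)

  start-strictly : ∀ s → Strictly (start s)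
  start-strictly s = let s′ , d = continue s in proj₂ (fromDescent s′ d)

  step : ∃ Rest → ∃ Rest
  step (_ , rest s _ [])       = _ , start s
  step (_ , rest s _ (e ∷ w))  = _ , rest s e w

  run : ∃ Rest → ℕ → ∃ Rest
  run r zero    = r
  run r (suc k) = run (step r) k

  firstLabel : ∃ Rest → Label
  firstLabel (_ , rest _ {l = l} _ _) = l

  runArc : ∀ r k → D (proj₁ (run r k)) (firstLabel (run r k)) (proj₁ (run r (suc k)))
  runArc (_ , rest s e [])       zero    = e
  runArc (_ , rest s e (e′ ∷ w)) zero    = e
  runArc r                       (suc k) = runArc (step r) k

  strict-soon : ∀ (r : Rest u) → Strictly r → ∃[ m ] firstLabel (run (_ , r) m) ≡ strict
  strict-soon (rest s e w) = go e w
    where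
    go : ∀ {u l v} (e : D u l v) (w : Walk D v (place s)) → Strictly (rest s e w) →
         ∃[ m ] firstLabel (run (_ , rest s e w) m) ≡ strict
    go e w        (inj₁ eq) = 0 , eq
    go e (e′ ∷ w) (inj₂ d)  = let m , eq = go e′ w d in suc m , eq

  -- The strict arc of the current descent may already lie behind. The remainder is finite, and the
  -- descent loaded after it brings a strict arc.
  strict-eventually : ∀ (r : Rest u) → ∃[ m ] firstLabel (run (_ , r) m) ≡ strict
  strict-eventually (rest s e w) = go e w
    where
    go : ∀ {u l v} (e : D u l v) (w : Walk D v (place s)) →
         ∃[ m ] firstLabel (run (_ , rest s e w) m) ≡ strict
    go e []       = let m , eq = strict-soon (start s) (start-strictly s) in suc m , eq
    go e (e′ ∷ w) = let m , eq = go e′ w in suc m , eq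

  strict-after : ∀ r k → ∃[ m ] (k ≤ m × firstLabel (run r m) ≡ strict)
  strict-after (_ , r) zero    = let m , eq = strict-eventually r in m , z≤n , eq
  strict-after r       (suc k) = let m , k≤m , eq = strict-after (step r) k in suc m , s≤s k≤m , eq

  concatenation : S → Σ[ w ∈ InfiniteWalk D ] InfinitelyDescending D w
  concatenation s = record
    { node  = λ k → proj₁ (run (_ , start s) k)
    ; label = λ k → firstLabel (run (_ , start s) k)
    ; arc   = runArc (_ , start s)
    } , strict-after (_ , start s)

-- Values never rise along a walk and fall at each strict arc, so a descending closed walk would put
-- the value of `u` below itself.
satisfiable⇒¬descent : Satisfiable D → ¬ Descent D u u
satisfiable⇒¬descent {D = D} (W , _ , σ , σ-strict , σ-nonstrict) (w , d) =
  W.irrefl W.Eq.refl (descent w d)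
  where
  module W = StrictTotalOrder W

  _≼_ : W.Carrier → W.Carrier → Set
  a ≼ b = a W.< b ⊎ a W.≈ b

  ≼-<-trans : ∀ {a b c} → a ≼ b → b W.< c → a W.< c
  ≼-<-trans (inj₁ a<b) b<c = W.trans a<b b<c
  ≼-<-trans (inj₂ a≈b) b<c = W.<-respˡ-≈ (W.Eq.sym a≈b) b<c

  <-≼-trans : ∀ {a b c} → a W.< b → b ≼ c → a W.< c
  <-≼-trans a<b (inj₁ b<c) = W.trans a<b b<c
  <-≼-trans a<b (inj₂ b≈c) = W.<-respʳ-≈ b≈c a<b

  ≼-trans : ∀ {a b c} → a ≼ b → b ≼ c → a ≼ c
  ≼-trans (inj₁ a<b) b≼c        = inj₁ (<-≼-trans a<b b≼c)
  ≼-trans (inj₂ a≈b) (inj₁ b<c) = inj₁ (≼-<-trans (inj₂ a≈b) b<c)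
  ≼-trans (inj₂ a≈b) (inj₂ b≈c) = inj₂ (W.Eq.trans a≈b b≈c)

  σ-arc : ∀ {u l v} → D u l v → σ v ≼ σ u
  σ-arc {l = strict}    e = inj₁ (σ-strict e)
  σ-arc {l = nonstrict} e = σ-nonstrict e

  walk : ∀ {u v} → Walk D u v → σ v ≼ σ u
  walk []      = inj₂ W.Eq.refl
  walk (e ∷ w) = ≼-trans (walk w) (σ-arc e)

  descent : ∀ {u v} (w : Walk D u v) → Descending w → σ v W.< σ u
  descent (e ∷ w) (inj₁ refl) = ≼-<-trans (walk w) (σ-strict e)
  descent (e ∷ w) (inj₂ d)    = <-≼-trans (descent w d) (σ-arc e)

-- Collapses

-- Every filtering of a fixed list occurs here, so collapses take finitely many values and can serve
-- as colours.
sublists : List C → List (List C)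
sublists []       = [] ∷ []
sublists (c ∷ cs) = map (c ∷_) (sublists cs) ++ sublists cs

allVars : ∀ n → List (Var n)
allVars n = map x (allFin n) ++ map x′ (allFin n)

∈-allVars : (u : Var n) → u ∈ allVars n
∈-allVars     (x i)  = ∈-++⁺ˡ (∈-map⁺ x (∈-allFin i))
∈-allVars {n} (x′ i) = ∈-++⁺ʳ (map x (allFin n)) (∈-map⁺ x′ (∈-allFin i))

allConstraints : ∀ n → MC n
allConstraints n =
  cartesianProduct (allVars n) (cartesianProduct (strict ∷ nonstrict ∷ []) (allVars n))

∈-allConstraints : (c : Constraint (Var n)) → c ∈ allConstraints n
∈-allConstraints (u , l , v) =
  ∈-cartesianProduct⁺ (∈-allVars u) (∈-cartesianProduct⁺ (∈-labels l) (∈-allVars v))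
  where
  ∈-labels : ∀ l → l ∈ strict ∷ nonstrict ∷ []
  ∈-labels strict    = here refl
  ∈-labels nonstrict = there (here refl)

collapseArc : {𝒜 : MCS n} {p : FinitePath 𝒜 ℓ} {G : MC n} → IsCollapse p G → ∀ {u v} →
              (a : Walk (Multipath p) (at zero (fromℕ ℓ) u) (at zero (fromℕ ℓ) v)) →
              ∃[ l ] ((u , l , v) ∈ G × (Descending a → l ≡ strict))
collapseArc col {u} {v} a =
  let l , m = from (IsCollapse.arc⇔walk col u v) a
  in l , m , λ d → from (IsCollapse.strict⇔desc col m) (a , d)

collapseRun : {𝒜 : MCS n} {p : FinitePath 𝒜 ℓ} {G : MC n} → IsCollapse p G → ∀ {u l v} →
              (u , l , v) ∈ G → Run (Multipath p) (at zero (fromℕ ℓ) u) l (at zero (fromℕ ℓ) v)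
collapseRun col {l = strict} m =
  let w , d = to (IsCollapse.strict⇔desc col m) refl in w , λ _ → d
collapseRun col {u} {nonstrict} {v} m =
  to (IsCollapse.arc⇔walk col u v) (_ , m) , λ ()

-- Repeating a cyclic multipath

module Repetition {𝒜 : MCS n} (p : FinitePath 𝒜 (suc ℓ))
                  (closed : Path.point p zero ≡ Path.point p (fromℕ (suc ℓ))) where
  open MCS 𝒜
  open Path p

  -- (c , r) is the r-th step of copy c of the multipath.
  advance : ℕ × Fin (suc ℓ) → ℕ × Fin (suc ℓ)
  advance (c , r) with view r
  ... | ‵fromℕ     = suc c , zero
  ... | ‵inject₁ j = c , suc j

  place : ℕ → ℕ × Fin (suc ℓ)
  place zero    = 0 , zero
  place (suc t) = advance (place t)

  arrives-advance : ∀ c r → target (arc r) ≡ point (inject₁ (proj₂ (advance (c , r))))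
  arrives-advance c r with view r
  -- The last step of a copy reaches the final flow-point, which `closed` identifies with the first
  -- one of the next copy.
  ... | ‵fromℕ     = trans (arrives (fromℕ ℓ)) (sym closed)
  ... | ‵inject₁ j = arrives (inject₁ j)

  repeated : InfinitePath 𝒜
  repeated = record
    { point   = λ t → point (inject₁ (proj₂ (place t)))
    ; arc     = λ t → arc (proj₂ (place t))
    ; departs = λ t → departs (proj₂ (place t))
    ; arrives = λ t → arrives-advance (proj₁ (place t)) (proj₂ (place t))
    }

  -- Copies of the multipath, the end of each joined to the start of the next
  -- by shortcuts instead of being identified with it.
  data Unrolled : Digraph (ℕ × (Fin (suc (suc ℓ)) × Fin n)) where
    inside   : ∀ {c q l q′} → Multipath p q l q′ → Unrolled (c , q) l (c , q′)
    toNext   : ∀ {c i} → Unrolled (c , (fromℕ (suc ℓ) , i)) nonstrict (suc c , (zero , i))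
    fromNext : ∀ {c i} → Unrolled (suc c , (zero , i)) nonstrict (c , (fromℕ (suc ℓ) , i))

  -- A node on the border of two copies is always placed at the start of the later one.
  unroll : (ℕ × Fin (suc ℓ)) × Fin n → ℕ × (Fin (suc (suc ℓ)) × Fin n)
  unroll ((c , r) , i) = c , (inject₁ r , i)

  -- Only a target variable of a copy's last step is misplaced by `unroll`; a shortcut repairs this.
  -- Arcs may also start at a target variable, hence `enter` as well as `leave`.
  enter : ∀ c r u → Walk Unrolled (unroll (at (c , r) (advance (c , r)) u))
                                  (c , at (inject₁ r) (suc r) u)
  enter c r (x i) = []
  enter c r (x′ i) with view r
  ... | ‵fromℕ     = fromNext ∷ []
  ... | ‵inject₁ j = []

  leave : ∀ c r u → Walk Unrolled (c , at (inject₁ r) (suc r) u)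
                                  (unroll (at (c , r) (advance (c , r)) u))
  leave c r (x i) = []
  leave c r (x′ i) with view r
  ... | ‵fromℕ     = toNext ∷ []
  ... | ‵inject₁ j = []

  unrollNode : ℕ × Fin n → ℕ × (Fin (suc (suc ℓ)) × Fin n)
  unrollNode (t , i) = unroll (place t , i)

  unroll-at : ∀ t u → unrollNode (at t (suc t) u) ≡ unroll (at (place t) (advance (place t)) u)
  unroll-at t (x i)  = refl
  unroll-at t (x′ i) = refl

  unroll-simulates : Simulates (Multipath repeated) Unrolled unrollNode
  unroll-simulates (transition t {u} {l} {v} m) =
    subst₂ (λ y z → Run Unrolled y l z) (sym (unroll-at t u)) (sym (unroll-at t v))
      ( enter c r u ++ʷ (inside (transition r m) ∷ leave c r v)
      , λ e → descending-++ʳ (enter c r u) (inj₁ e))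
    where
    c = proj₁ (place t)
    r = proj₂ (place t)
  unroll-simulates (invariant t m) = arcRun (inside (invariant (inject₁ (proj₂ (place t))) m))

  -- Cutting unrolled walks at the borders of copies

  module _ {G : MC n} (col : IsCollapse p G) where

    boundary : Var n → Fin (suc (suc ℓ)) × Fin n
    boundary = at zero (fromℕ (suc ℓ))

    -- The pieces before the first and after the last shortcut stay walks of the multipath;
    -- everything between is compressed to a walk in G°. The field `copies` says that c′ minus c is
    -- backward minus forward, written without subtraction.
    record Crossing (c : ℕ) (q : Fin (suc (suc ℓ)) × Fin n)
                    (c′ : ℕ) (q′ : Fin (suc (suc ℓ)) × Fin n) : Set where
      constructor crossing
      field
        {first last} : Var n
        initial      : Walk (Multipath p) q (boundary first)
        middle       : Walk (Circular G) first last
        final        : Walk (Multipath p) (boundary last) q′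
        copies       : #forward middle + c′ ≡ #backward middle + c

      DescendingCrossing : Set
      DescendingCrossing = Descending initial ⊎ Descending middle ⊎ Descending final

    open Crossing using (DescendingCrossing)

    Cut : ∀ {c q c′ q′} → Walk Unrolled (c , q) (c′ , q′) → Set
    Cut {c} {q} {c′} {q′} w =
      (c ≡ c′ × Σ[ a ∈ Walk (Multipath p) q q′ ] (Descending w → Descending a)) ⊎
      (Σ[ k ∈ Crossing c q c′ q′ ] (Descending w → DescendingCrossing k))

    -- Returning to the previous copy reads as a forward shortcut. If the rest crosses again, its
    -- initial piece now runs from boundary to boundary and collapses to one arc of G.
    cut-forward : ∀ {c i c′ q′} (w : Walk Unrolled (c , boundary (x′ i)) (c′ , q′)) →
                  Cut w → Cut (fromNext {c} {i} ∷ w)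
    cut-forward {i = i} w (inj₁ (refl , a , h)) =
      inj₂ (crossing [] (forward i ∷ []) a refl , λ { (inj₂ d) → inj₂ (inj₂ (h d)) })
    cut-forward {i = i} w (inj₂ (crossing a b a′ eq , h)) =
      let l , m , s = collapseArc col a in
      inj₂ ( crossing [] (forward i ∷ original m ∷ b) a′ (trans (cong suc eq) (sym (+-suc _ _)))
           , λ { (inj₂ d) → inj₂ ([ inj₁ ∘ inj₂ ∘ inj₁ ∘ s
                                  , [ inj₁ ∘ inj₂ ∘ inj₂ , inj₂ ] ] (h d)) })

    cut-backward : ∀ {c i c′ q′} (w : Walk Unrolled (suc c , boundary (x i)) (c′ , q′)) →
                   Cut w → Cut (toNext {c} {i} ∷ w)
    cut-backward {i = i} w (inj₁ (refl , a , h)) =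
      inj₂ (crossing [] (backward i ∷ []) a refl , λ { (inj₂ d) → inj₂ (inj₂ (h d)) })
    cut-backward {i = i} w (inj₂ (crossing a b a′ eq , h)) =
      let l , m , s = collapseArc col a in
      inj₂ ( crossing [] (backward i ∷ original m ∷ b) a′ (trans eq (+-suc _ _))
           , λ { (inj₂ d) → inj₂ ([ inj₁ ∘ inj₂ ∘ inj₁ ∘ s
                                  , [ inj₁ ∘ inj₂ ∘ inj₂ , inj₂ ] ] (h d)) })

    cut : ∀ {c q c′ q′} (w : Walk Unrolled (c , q) (c′ , q′)) → Cut w
    cut []             = inj₁ (refl , [] , λ ())
    cut (fromNext ∷ w) = cut-forward w (cut w)
    cut (toNext ∷ w)   = cut-backward w (cut w)
    cut (inside e ∷ w) with cut w
    ... | inj₁ (eq , a , h) = inj₁ (eq , e ∷ a , λ { (inj₁ s) → inj₁ s ; (inj₂ d) → inj₂ (h d) })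
    ... | inj₂ (crossing a b a′ eq , h) =
      inj₂ ( crossing (e ∷ a) b a′ eq
           , λ { (inj₁ s) → inj₁ (inj₁ s) ; (inj₂ d) → [ inj₁ ∘ inj₂ , inj₂ ] (h d) })

    -- A walk within one copy would be a descending cycle of the multipath. Otherwise the final
    -- piece followed by the initial one, joined at `q`, collapses to an arc of G that closes
    -- `middle` into a cycle; `c ≤ c′` bounds its forward shortcuts by its backward ones.
    descent⇒test : Satisfiable (Multipath p) → ∀ {c c′ q} → c ≤ c′ →
                   Descent Unrolled (c , q) (c′ , q) → PassesLocalTerminationTest G
    descent⇒test sat c≤c′ (w , d) with cut w
    ... | inj₁ (_ , a , h) = ⊥-elim (satisfiable⇒¬descent sat (a , h d))
    ... | inj₂ (crossing a b a′ eq , h) =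
      let l , m , s = collapseArc col (a′ ++ʷ a)
      in _ , original m ∷ b
           , [ inj₁ ∘ s ∘ descending-++ʳ a′
             , [ inj₂ , inj₁ ∘ s ∘ descending-++ˡ a′ ] ] (h d)
           , m≤n⇒m<n∨m≡n
               (+-cancelʳ-≤ _ _ _ (≤-trans (+-monoʳ-≤ (#forward b) c≤c′) (≤-reflexive eq)))

-- Segments of an infinite path

module _ {𝒜 : MCS n} (p : InfinitePath 𝒜) where
  open Path p

  -- With the offset on the right, the time after a step is a successor by computation, so `arrives`
  -- needs no transport.
  segment : (a ℓ : ℕ) → FinitePath 𝒜 ℓ
  segment a ℓ = record
    { point   = λ t → point (toℕ t + a)
    ; arc     = λ s → arc (toℕ s + a)
    ; departs = λ s → trans (departs (toℕ s + a)) (cong (λ t → point (t + a)) (sym (toℕ-inject₁ s)))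
    ; arrives = λ s → arrives (toℕ s + a)
    }

  embed : ∀ a {ℓ} → Fin (suc ℓ) × Fin n → ℕ × Fin n
  embed a (t , i) = toℕ t + a , i

  embed-at : ∀ a {ℓ} (s : Fin ℓ) u →
             embed a (at (inject₁ s) (suc s) u) ≡ at (toℕ s + a) (suc (toℕ s + a)) u
  embed-at a s (x i)  = cong (λ t → t + a , i) (toℕ-inject₁ s)
  embed-at a s (x′ i) = refl

  embed-end : ∀ a ℓ u → embed a (at zero (fromℕ ℓ) u) ≡ at a (ℓ + a) u
  embed-end a ℓ (x i)  = refl
  embed-end a ℓ (x′ i) = cong (λ t → t + a , i) (toℕ-fromℕ ℓ)

  embed-simulates : ∀ a ℓ → Simulates (Multipath (segment a ℓ)) (Multipath p) (embed a)
  embed-simulates a ℓ (transition s {u} {l} {v} m) =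
    subst₂ (λ y z → Run (Multipath p) y l z) (sym (embed-at a s u)) (sym (embed-at a s v))
      (arcRun (transition (toℕ s + a) m))
  embed-simulates a ℓ (invariant t m) = arcRun (invariant (toℕ t + a) m)

  segmentRun : ∀ {a ℓ G} → IsCollapse (segment a ℓ) G → ∀ {u l v} → (u , l , v) ∈ G →
               Run (Multipath p) (at a (ℓ + a) u) l (at a (ℓ + a) v)
  segmentRun {a} {ℓ} col {u} {l} {v} m =
    let w , h = collapseRun col m in
    subst₂ (λ y z → Run (Multipath p) y l z) (embed-end a ℓ u) (embed-end a ℓ v)
      ( mapWalk (embed-simulates a ℓ) w
      , λ e → mapWalk-descending (embed-simulates a ℓ) w (h e))

-- Lifting cycles of G° to a path cut into segments that collapse to G

module _ {G : MC n} {D : Digraph (ℕ × Fin n)} (time : ℕ → ℕ)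
         (run : ∀ k {u l v} → (u , l , v) ∈ G →
                Run D (at (time k) (time (suc k)) u) l (at (time k) (time (suc k)) v)) where

  copy : Var n → ℕ → ℕ × Fin n
  copy u k = at (time k) (time (suc k)) u

  -- Arcs of G become runs; shortcuts vanish, since `x′ i` in copy k and `x i` in copy k + 1 are the
  -- same node. The bound on k pays for every forward shortcut, each of which lowers the copy by
  -- one.
  lift : ∀ {u v} (w : Walk (Circular G) u v) k → #forward w ≤ k →
         ∃[ k′ ] (#forward w + k′ ≡ #backward w + k ×
                  Σ[ w′ ∈ Walk D (copy u k) (copy v k′) ] (Descending w → Descending w′))
  lift []               k       _         = k , refl , [] , id
  lift (original m ∷ w) k       f≤k       =
    let k′ , eq , w′ , h = lift w k f≤k
        r , s = run k m
    in k′ , eq , r ++ʷ w′ , λ { (inj₁ e) → descending-++ˡ r (s e)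
                              ; (inj₂ d) → descending-++ʳ r (h d) }
  lift (forward i ∷ w)  (suc k) (s≤s f≤k) =
    let k′ , eq , w′ , h = lift w k f≤k
    in k′ , trans (cong suc eq) (sym (+-suc _ _)) , w′ , λ { (inj₂ d) → h d }
  lift (backward i ∷ w) k       f≤k       =
    let k′ , eq , w′ , h = lift w (suc k) (m≤n⇒m≤1+n f≤k)
    in k′ , trans eq (+-suc _ _) , w′ , λ { (inj₂ d) → h d }

  test⇒infinitelyDescending : PassesLocalTerminationTest G →
                              Σ[ w ∈ InfiniteWalk D ] InfinitelyDescending D w
  test⇒infinitelyDescending (u , c , d , fb) = concatenation (#forward c , ≤-refl)
    where
    f≤b : #forward c ≤ #backward c
    f≤b = [ <⇒≤ , ≤-reflexive ] fb

    -- Starting in a copy numbered at least #forward c keeps all visited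
    -- copies nonnegative.
    again : ((k , _) : Σ[ k ∈ ℕ ] #forward c ≤ k) →
            Σ[ (k′ , _) ∈ Σ[ k ∈ ℕ ] #forward c ≤ k ] Descent D (copy u k) (copy u k′)
    again (k , f≤k) =
      let k′ , eq , w , h = lift c k f≤k
          -- No copy is lost in a round, so the bound needed to lift the cycle holds again for the
          -- next round.
          k≤k′ = +-cancelˡ-≤ _ _ _ (≤-trans (+-monoˡ-≤ k f≤b) (≤-reflexive (sym eq)))
      in (k′ , ≤-trans f≤k k≤k′) , w , h d

    open Concatenation {D = D} (copy u ∘ proj₁) again

-- Infinite sets

Infinite : (ℕ → Set) → Set
Infinite P = ∀ k → ∃[ m ] (k ≤ m × P m)

module _ (em : ExcludedMiddle 0ℓ) where

  -- Induction on the list: either `c` recurs for ever, or it is avoided from some k on, and the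
  -- members of `P` from k on only take values in `cs`.
  pigeonhole : (cs : List C) (f : ℕ → C) (P : ℕ → Set) → Infinite P → (∀ {m} → P m → f m ∈ cs) →
               ∃[ c ] (c ∈ cs × Infinite (λ m → P m × f m ≡ c))
  pigeonhole []       f P inf f∈ with f∈ (proj₂ (proj₂ (inf 0)))
  ... | ()
  pigeonhole (c ∷ cs) f P inf f∈ with em {∃[ k ] (∀ {m} → k ≤ m → P m → f m ≢ c)}
  ... | yes (k , avoids) =
    let c′ , c′∈ , inf′ = pigeonhole cs f (λ m → k ≤ m × P m) infᵏ fᵏ∈
    in c′ , there c′∈ , λ j → let m , j≤m , (_ , Pm) , eq = inf′ j in m , j≤m , Pm , eq
    where
    infᵏ : Infinite (λ m → k ≤ m × P m)
    infᵏ j = let m , k+j≤m , Pm = inf (k + j) in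
             m , m+n≤o⇒n≤o k k+j≤m , m+n≤o⇒m≤o k k+j≤m , Pm
    fᵏ∈ : ∀ {m} → k ≤ m × P m → f m ∈ cs
    fᵏ∈ (k≤m , Pm) with f∈ Pm
    ... | here eq  = contradiction eq (avoids k≤m Pm)
    ... | there m∈ = m∈
  ... | no ¬avoids = c , here refl , recurs
    where
    recurs : Infinite (λ m → P m × f m ≡ c)
    recurs k with em {∃[ m ] (k ≤ m × P m × f m ≡ c)}
    ... | yes h = h
    ... | no ¬h = ⊥-elim (¬avoids (k , λ k≤m Pm eq → ¬h (_ , k≤m , Pm , eq)))

  -- Used to start from a visit in the lowest copy, so that no later visit lies in an earlier copy.
  minimiser : (P : ℕ → Set) (g : ℕ → ℕ) → ∃ P → ∃[ a ] (P a × (∀ {b} → P b → g a ≤ g b))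
  minimiser P g (m , Pm) = go m Pm (<-wellFounded (g m))
    where
    go : ∀ m → P m → Acc _<_ (g m) → ∃[ a ] (P a × (∀ {b} → P b → g a ≤ g b))
    go m Pm (acc rec) with em {∃[ b ] (P b × g b < g m)}
    ... | yes (b , Pb , lt) = go b Pb (rec lt)
    ... | no ¬smaller       = m , Pm , λ Pb → ≮⇒≥ (λ lt → ¬smaller (_ , Pb , lt))

  -- The infinite Ramsey argument

  module Ramsey (cs : List C) (χ : ℕ → ℕ → C) (χ∈ : ∀ a b → χ a b ∈ cs) where

    -- An infinite set of candidates with a chosen `head`. Some `colour` joins `head` to infinitely
    -- many later members, and `shrink` keeps exactly those, so `head` sees one colour in all later
    -- stages.
    record Stage : Set₁ where
      field
        Member   : ℕ → Set
        infinite : Infinite Member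

      head : ℕ
      head = proj₁ (infinite 0)

      head-member : Member head
      head-member = proj₂ (proj₂ (infinite 0))

      After : ℕ → Set
      After m = suc head ≤ m × Member m

      after-infinite : Infinite After
      after-infinite k = let m , le , Mm = infinite (suc head + k) in
        m , m+n≤o⇒n≤o (suc head) le , m+n≤o⇒m≤o (suc head) le , Mm

      recurring : ∃[ c ] (c ∈ cs × Infinite (λ m → After m × χ head m ≡ c))
      recurring = pigeonhole cs (χ head) After after-infinite (λ _ → χ∈ head _)

      colour : C
      colour = proj₁ recurring

    open Stage

    shrink : Stage → Stage
    shrink S = record
      { Member   = λ m → After S m × χ (head S) m ≡ colour S
      ; infinite = proj₂ (proj₂ (recurring S))
      }

    stage : ℕ → Stage
    stage zero    = record { Member = λ _ → ⊤ ; infinite = λ k → k , ≤-refl , tt }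
    stage (suc k) = shrink (stage k)

    stage-antitone : ∀ {j k} → j ≤′ k → ∀ {m} → Member (stage k) m → Member (stage j) m
    stage-antitone ≤′-refl     Mm              = Mm
    stage-antitone (≤′-step p) ((_ , Mm) , _)  = stage-antitone p Mm

    -- The head of stage k belongs to stage j + 1, whose members all come after the head of stage j
    -- and are joined to it by its colour.
    head-later : ∀ {j k} → j < k → head (stage j) < head (stage k) ×
                                   χ (head (stage j)) (head (stage k)) ≡ colour (stage j)
    head-later {j} {k} j<k =
      let (lt , _) , eq = stage-antitone (≤⇒≤′ j<k) (head-member (stage k)) in lt , eq

    -- The colour between two heads depends on the earlier one only, so a second pigeonhole, over
    -- the stages, leaves a single colour.
    homogeneous : ∃[ c ] Σ[ t ∈ (ℕ → ℕ) ] (∀ k → t k < t (suc k) × χ (t k) (t (suc k)) ≡ c)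
    homogeneous =
      let c , _ , inf = pigeonhole cs (λ k → colour (stage k)) (λ _ → ⊤)
                          (λ k → k , ≤-refl , tt) (λ {k} _ → proj₁ (proj₂ (recurring (stage k))))
      in c , head ∘ stage ∘ index inf , λ k →
           let lt , eq = head-later (index-< inf k) in lt , trans eq (index-colour inf k)
      where
      module _ {c} (inf : Infinite (λ k → ⊤ × colour (stage k) ≡ c)) where
        index : ℕ → ℕ
        index zero    = proj₁ (inf 0)
        index (suc k) = proj₁ (inf (suc (index k)))

        index-< : ∀ k → index k < index (suc k)
        index-< k = proj₁ (proj₂ (inf (suc (index k))))

        index-colour : ∀ k → colour (stage (index k)) ≡ c
        index-colour zero    = proj₂ (proj₂ (proj₂ (inf 0)))
        index-colour (suc k) = proj₂ (proj₂ (proj₂ (inf (suc (index k)))))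

  -- Filtering and counting by excluded middle

  filterₑₘ : (P : C → Set) → List C → List C
  filterₑₘ P = filter (λ c → em {P c})

  filter∈sublists : (P : C → Set) (cs : List C) → filterₑₘ P cs ∈ sublists cs
  filter∈sublists P []       = here refl
  filter∈sublists P (c ∷ cs) with em {P c}
  ... | yes _ = ∈-++⁺ˡ (∈-map⁺ (c ∷_) (filter∈sublists P cs))
  ... | no  _ = ∈-++⁺ʳ (map (c ∷_) (sublists cs)) (filter∈sublists P cs)

  count : (C → Set) → List C → ℕ
  count P cs = length (filterₑₘ P cs)

  count-mono : {P Q : C → Set} → (∀ {c} → P c → Q c) → ∀ cs → count P cs ≤ count Q cs
  count-mono P⊆Q [] = z≤n
  count-mono {P = P} {Q} P⊆Q (c ∷ cs) with em {P c} | em {Q c}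
  ... | yes _ | yes _ = s≤s (count-mono P⊆Q cs)
  ... | yes p | no ¬q = contradiction (P⊆Q p) ¬q
  ... | no _  | yes _ = m≤n⇒m≤1+n (count-mono P⊆Q cs)
  ... | no _  | no _  = count-mono P⊆Q cs

  count-strict : {P Q : C → Set} → (∀ {c} → P c → Q c) → ∀ {c cs} → c ∈ cs → ¬ P c → Q c →
                 count P cs < count Q cs
  count-strict {P = P} {Q} P⊆Q {cs = c ∷ cs} (here refl) ¬p q with em {P c} | em {Q c}
  ... | yes p | _     = contradiction p ¬p
  ... | no _  | yes _ = s≤s (count-mono P⊆Q cs)
  ... | no _  | no ¬q = contradiction q ¬q
  count-strict {P = P} {Q} P⊆Q {cs = c ∷ cs} (there c∈) ¬p q with em {P c} | em {Q c}
  ... | yes _ | yes _ = s≤s (count-strict P⊆Q c∈ ¬p q)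
  ... | yes p | no ¬q = contradiction (P⊆Q p) ¬q
  ... | no _  | yes _ = m≤n⇒m≤1+n (count-strict P⊆Q c∈ ¬p q)
  ... | no _  | no _  = count-strict P⊆Q c∈ ¬p q

  -- The value of a node is the number of nodes strictly below it.
  ¬descent⇒satisfiable : {D : Digraph V} (vs : List V) → (∀ v → v ∈ vs) →
                         (∀ u → ¬ Descent D u u) → Satisfiable D
  ¬descent⇒satisfiable {D = D} vs ∈vs acyclic =
    <-strictTotalOrder , <-wellFounded , (λ u → count (Descent D u) vs) ,
    -- All that lies below v lies below u, and v itself is below u but, by acyclicity, not below v.
    (λ {u} {v} e → count-strict (extend e) (∈vs v) (acyclic v) (e ∷ [] , inj₁ refl)) ,
    (λ e → m≤n⇒m<n∨m≡n (count-mono (extend e) vs))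
    where
    extend : ∀ {u l v w} → D u l v → Descent D v w → Descent D u w
    extend e (w , d) = e ∷ w , inj₂ d

  -- Existence of the collapse

  module _ {𝒜 : MCS n} (p : FinitePath 𝒜 ℓ) where

    -- The equivalence leaves exactly one label for each connected pair, so the strongest constraint
    -- alone is kept.
    Implied : Constraint (Var n) → Set
    Implied (u , l , v) =
      Walk (Multipath p) (at zero (fromℕ ℓ) u) (at zero (fromℕ ℓ) v) ×
      (l ≡ strict ⇔ Descent (Multipath p) (at zero (fromℕ ℓ) u) (at zero (fromℕ ℓ) v))

    collapse : MC n
    collapse = filterₑₘ Implied (allConstraints n)

    collapse-isCollapse : IsCollapse p collapse
    collapse-isCollapse = record
      { arc⇔walk    = λ u v → mk⇔ (λ (_ , m) → proj₁ (implied m)) (present u v)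
      ; strict⇔desc = λ m → proj₂ (implied m)
      }
      where
      implied : ∀ {c} → c ∈ collapse → Implied c
      implied = proj₂ ∘ ∈-filter⁻ (λ c → em {Implied c}) {xs = allConstraints n}

      present : ∀ u v → Walk (Multipath p) (at zero (fromℕ ℓ) u) (at zero (fromℕ ℓ) v) →
                ∃[ l ] (u , l , v) ∈ collapse
      present u v w
        with em {Descent (Multipath p) (at zero (fromℕ ℓ) u) (at zero (fromℕ ℓ) v)}
      ... | yes d = strict ,
        ∈-filter⁺ (λ c → em {Implied c}) (∈-allConstraints _) (w , mk⇔ (λ _ → d) (λ _ → refl))
      ... | no ¬d = nonstrict ,
        ∈-filter⁺ (λ c → em {Implied c}) (∈-allConstraints _)
          (w , mk⇔ (λ ()) (λ d → contradiction d ¬d))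

  -- Termination implies the test

  terminating⇒test : {𝒜 : MCS n} → SizeChangeTerminating 𝒜 →
                     ∀ f G → InClosure 𝒜 f f G → PassesLocalTerminationTest G
  terminating⇒test {n} {𝒜} sct f G (ℓ , p , begins , ends , sat , col) =
    uncurry descending⇒test (sct repeated)
    where
    open Repetition p (trans begins (sym ends))

    module _ (w : InfiniteWalk (Multipath repeated))
             (desc : InfinitelyDescending (Multipath repeated) w) where
      open InfiniteWalk w using (node)

      copyAt : ℕ → ℕ
      copyAt m = proj₁ (unrollNode (node m))

      spotAt : ℕ → Fin (suc (suc ℓ)) × Fin n
      spotAt m = proj₂ (unrollNode (node m))

      revisited : ∃[ q ] Infinite (λ m → ⊤ × spotAt m ≡ q)
      revisited with pigeonhole (cartesianProduct (allFin _) (allFin n)) spotAt (λ _ → ⊤)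
                       (λ k → k , ≤-refl , tt)
                       (λ _ → ∈-cartesianProduct⁺ (∈-allFin _) (∈-allFin _))
      ... | q , _ , inf = q , inf

      descending⇒test : PassesLocalTerminationTest G
      descending⇒test with revisited
      ... | q , inf with inf 0
      ... | m , _ , _ , eq with minimiser (λ m → spotAt m ≡ q) copyAt (m , eq)
      -- Take a strict arc after visit `a`, then a visit to the same spot after that arc; the piece
      -- between the visits descends.
      ... | a , eqᵃ , least with desc a
      ... | s , a≤s , eqˢ with inf (suc s)
      ... | b , s<b , _ , eqᵇ =
        descent⇒test col sat (least eqᵇ)
          (subst₂ (λ q q′ → Descent Unrolled (copyAt a , q) (copyAt b , q′)) eqᵃ eqᵇ
            (mapDescent unroll-simulates (subwalk-through w eqˢ a≤s s<b)))

  -- The test implies termination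

  module _ {𝒜 : MCS n} (passes : ∀ f G → InClosure 𝒜 f f G → PassesLocalTerminationTest G)
           (p : InfinitePath 𝒜) where
    open Path p using (point)

    -- One less than the length from a to b, as members of the closure have at least one arc. For b
    -- ≤ a it is zero, which keeps the colouring total.
    gapAfter : ℕ → ℕ → ℕ
    gapAfter a b = b ∸ suc a

    gapAfter-+ : ∀ {a b} → a < b → suc (gapAfter a b) + a ≡ b
    gapAfter-+ {a} {b} a<b = trans (sym (+-suc (gapAfter a b) a)) (m∸n+n≡m a<b)

    between : ∀ a b → FinitePath 𝒜 (suc (gapAfter a b))
    between a b = segment p a (suc (gapAfter a b))

    -- Recording the flow-point makes segments of one colour cyclic.
    χ : ℕ → ℕ → MCS.FlowPoint 𝒜 × MC n
    χ a b = point a , collapse (between a b)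

    homogeneous⇒infinitelyDescending :
      (∀ a b → Satisfiable (Multipath (between a b))) →
      ∀ {f G} (t : ℕ → ℕ) → (∀ k → t k < t (suc k) × χ (t k) (t (suc k)) ≡ (f , G)) →
      Σ[ w ∈ InfiniteWalk (Multipath p) ] InfinitelyDescending (Multipath p) w
    homogeneous⇒infinitelyDescending sat {f} {G} t hom =
      test⇒infinitelyDescending t run (passes f G inClosure)
      where
      collapses : ∀ k → IsCollapse (between (t k) (t (suc k))) G
      collapses k =
        subst (IsCollapse _) (cong proj₂ (proj₂ (hom k))) (collapse-isCollapse (between (t k) (t (suc k))))

      run : ∀ k {u l v} → (u , l , v) ∈ G →
            Run (Multipath p) (at (t k) (t (suc k)) u) l (at (t k) (t (suc k)) v)
      run k {u} {l} {v} m =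
        subst (λ b → Run (Multipath p) (at (t k) b u) l (at (t k) b v)) (gapAfter-+ (proj₁ (hom k)))
          (segmentRun p (collapses k) m)

      point-eq : ∀ k → point (t k) ≡ f
      point-eq k = cong proj₁ (proj₂ (hom k))

      -- The first segment ends where the second starts, and the colour of the second also records
      -- `f`.
      last-point : point (toℕ (fromℕ (suc (gapAfter (t 0) (t 1)))) + t 0) ≡ f
      last-point =
        trans (cong point (trans (cong (_+ t 0) (toℕ-fromℕ _)) (gapAfter-+ (proj₁ (hom 0)))))
              (point-eq 1)

      inClosure : InClosure 𝒜 f f G
      inClosure =
        gapAfter (t 0) (t 1) , between (t 0) (t 1) , point-eq 0 , last-point ,
        sat (t 0) (t 1) , collapses 0

    test⇒terminating : Σ[ w ∈ InfiniteWalk (Multipath p) ] InfinitelyDescending (Multipath p) w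
    -- The split is on descending cycles because `em` decides types in `Set`, while `Satisfiable`
    -- lies in `Set₁`.
    test⇒terminating with em {Σ[ a ∈ ℕ ] Σ[ ℓ ∈ ℕ ] ∃[ u ] Descent (Multipath (segment p a ℓ)) u u}
    ... | yes (a , ℓ , u , d) = concatenation tt
      where
      open Concatenation {D = Multipath p} {S = ⊤} (λ _ → embed p a u)
             (λ _ → tt , mapDescent (embed-simulates p a ℓ) d)
    ... | no ¬cycle = splits homogeneous
      where
      open Ramsey (cartesianProduct (allFin _) (sublists (allConstraints n))) χ
        (λ a b → ∈-cartesianProduct⁺ (∈-allFin _) (filter∈sublists _ (allConstraints n)))

      splits : (∃[ c ] Σ[ t ∈ (ℕ → ℕ) ] (∀ k → t k < t (suc k) × χ (t k) (t (suc k)) ≡ c)) →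
               Σ[ w ∈ InfiniteWalk (Multipath p) ] InfinitelyDescending (Multipath p) w
      splits (_ , t , hom) = homogeneous⇒infinitelyDescending
        (λ a b → ¬descent⇒satisfiable (cartesianProduct (allFin _) (allFin n))
                   (λ _ → ∈-cartesianProduct⁺ (∈-allFin _) (∈-allFin _))
                   (λ u d → ¬cycle (a , _ , u , d)))
        t hom

theorem4p12 : ExcludedMiddle 0ℓ →
    (n : ℕ) (𝒜 : MCS n) →
    SizeChangeTerminating 𝒜 ⇔
    ((f : MCS.FlowPoint 𝒜) (G : MC n) → InClosure 𝒜 f f G → PassesLocalTerminationTest G)
theorem4p12 em n 𝒜 = mk⇔ (terminating⇒test em) (test⇒terminating em)
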